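{- Let $D$ be a weakly connected finite digraph (loops allowed, no parallel arcs) with $|V(D)|\ge 2$, and set $m=|A(D)|$. If $D$ does not have loops, or if $D$ has loops and $Z(L(D))>0$, then $$F(L(D))=\begin{cases}0 & \text{if } D \text{ is a directed cycle},\\ m-1 & \text{if } D\text{ has a source},\\ m-2 & \text{otherwise.}\end{cases}$$
   Context: A digraph $D=(V,A)$ has finite vertex set $V$ and arc set $A\subseteq V\times V$; an arc $(u,v)$ has tail $u$ and head $v$; a loop is an arc $(u,u)$. $N_D^+(v)=\{u:(v,u)\in A\}$, $N_D^-(v)=\{u:(u,v)\in A\}$ (so if $(u,u)\in A$ then $u\in N_D^+(u)$ and $u\in N_D^-(u)$). A source is a vertex with $N_D^-(v)=\emptyset$. $D$ is weakly connected if its underlying undirected graph is connected. $D$ is a directed cycle if its vertices can be labeled $v_1,\dots,v_n$ so that its arcs are exactly $(v_1,v_2),\dots,(v_{n-1},v_n),(v_n,v_1)$. The line digraph $L(D)$ has vertex set $V(L(D))=A(D)$ and an arc from $a$ to $b$ exactly when the head of $a$ is the tail of $b$ in $D$. Zero forcing on a digraph $H$ without loops: for $S\subseteq V(H)$, $B^0(S)=S$ and $B^{i+1}(S)=B^i(S)\cup\{w:\{w\}=N_H^+(v)\setminus B^i(S)\text{ for some }v\in B^i(S)\}$. On a digraph $H$ with (at least one) loop, the rule is instead $B^{i+1}(S)=B^i(S)\cup\{w:\{w\}=N_H^+(v)\setminus B^i(S)\text{ for some }v\in V(H)\}$. In either case $S$ is a zero forcing set (ZFS) if $B^t(S)=V(H)$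 for some $t\ge 0$, and a failed zero forcing set (FZFS) otherwise. $Z(H)$ is the smallest cardinality of a ZFS (possibly $0$ when $H$ has loops); $F(H)$ is the largest cardinality of an FZFS (for $H$ with loops, it is undefined exactly when $Z(H)=0$). -}

module Defs where

open import Data.Bool.Properties using () renaming (_≟_ to _≟ᵇ_)
open import Data.Fin using (Fin; toℕ)
open import Data.Fin.Properties using (any?) renaming (_≟_ to _≟ᶠ_)
open import Data.Fin.Permutation using (Permutation′; _⟨$⟩ʳ_)
open import Data.Fin.Subset using (Subset; ⊤; ⁅_⁆; _∈_; _∪_; _─_; ∣_∣; Empty)
open import Data.Fin.Subset.Properties using (_∈?_)
open import Data.List using (List; length; lookup; filter; allFin; cartesianProduct)
open import Data.List.Membership.Propositional using () renaming (_∈_ to _∈ˡ_)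
open import Data.List.Membership.Propositional.Properties
  using (∈-filter⁺; ∈-filter⁻; ∈-cartesianProduct⁺; ∈-allFin)
open import Data.List.Relation.Unary.Unique.Propositional using (Unique)
open import Data.List.Relation.Unary.Unique.Propositional.Properties
  using (filter⁺; cartesianProduct⁺; allFin⁺)
open import Data.Nat using (ℕ; zero; suc; _≤_)
open import Data.Product using (_×_; _,_; proj₁; proj₂; Σ; ∃-syntax)
open import Data.Sum using (_⊎_)
open import Data.Vec using (tabulate)
open import Data.Vec.Properties using (≡-dec)
open import Function.Bundles using (_⇔_; mk⇔)
open import Level using (0ℓ)
open import Relation.Binary using (Rel; Decidable; DecidableEquality)
open import Relation.Binary.Construct.Closure.Equivalence using (EqClosure)
open import Relation.Binary.PropositionalEquality using (_≡_)
open import Relation.Nullary using (Dec; ¬_; does; _×-dec_; _⊎-dec_)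

private
  variable
    n : ℕ

-- Arc is only ever used as a relation (a subset of V × V), so there are
-- no parallel arcs even if some type Arc u v has several inhabitants.
record Digraph (n : ℕ) : Set₁ where
  field
    Arc  : Rel (Fin n) 0ℓ
    arc? : Decidable Arc

open Digraph public

N⁺ : Digraph n → Fin n → Subset n
N⁺ D v = tabulate λ u → does (arc? D v u)

N⁻ : Digraph n → Fin n → Subset n
N⁻ D v = tabulate λ u → does (arc? D u v)

HasLoop : Digraph n → Set
HasLoop D = ∃[ u ] Arc D u u

hasLoop? : (D : Digraph n) → Dec (HasLoop D)
hasLoop? D = any? λ u → arc? D u u

HasSource : Digraph n → Set
HasSource D = ∃[ v ] Empty (N⁻ D v)

WeaklyConnected : Digraph n → Set
WeaklyConnected D = ∀ u v → EqClosure (Arc D) u v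

CyclicSucc : Rel (Fin n) 0ℓ
CyclicSucc {n} i j = suc (toℕ i) ≡ toℕ j ⊎ (suc (toℕ i) ≡ n × toℕ j ≡ 0)

IsDirectedCycle : Digraph n → Set
IsDirectedCycle {n} D = Σ (Permutation′ n) λ v →
  ∀ i j → Arc D (v ⟨$⟩ʳ i) (v ⟨$⟩ʳ j) ⇔ CyclicSucc i j

-- The arc set, as a duplicate-free list of (tail , head) pairs.
arcs : Digraph n → List (Fin n × Fin n)
arcs {n} D =
  filter (λ a → arc? D (proj₁ a) (proj₂ a)) (cartesianProduct (allFin n) (allFin n))

arcs-unique : (D : Digraph n) → Unique (arcs D)
arcs-unique {n} D =
  filter⁺ (λ a → arc? D (proj₁ a) (proj₂ a)) (cartesianProduct⁺ (allFin⁺ n) (allFin⁺ n))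

∈-arcs : (D : Digraph n) → ∀ u v → (u , v) ∈ˡ arcs D ⇔ Arc D u v
∈-arcs {n} D u v = mk⇔
  (λ p → proj₂ (∈-filter⁻ P? {xs = cartesianProduct (allFin n) (allFin n)} p))
  (∈-filter⁺ P? (∈-cartesianProduct⁺ (∈-allFin u) (∈-allFin v)))
  where P? = λ (a : Fin n × Fin n) → arc? D (proj₁ a) (proj₂ a)

∣A∣ : Digraph n → ℕ
∣A∣ D = length (arcs D)

tail head : (D : Digraph n) → Fin (∣A∣ D) → Fin n
tail D a = proj₁ (lookup (arcs D) a)
head D a = proj₂ (lookup (arcs D) a)

-- The vertices of L(D) are the arcs of D, named by their position in arcs D.
L : (D : Digraph n) → Digraph (∣A∣ D)
L D .Arc  a b = head D a ≡ tail D b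
L D .arc? a b = head D a ≟ᶠ tail D b

_≟ˢ_ : DecidableEquality (Subset n)
_≟ˢ_ = ≡-dec _≟ᵇ_

-- v may force w when the current set is B.  The first conjunct combines the
-- two rules: without loops v must lie in B, with a loop v is arbitrary.
Forces : Digraph n → Subset n → Rel (Fin n) 0ℓ
Forces H B v w = (HasLoop H ⊎ v ∈ B) × ⁅ w ⁆ ≡ N⁺ H v ─ B

forces? : (H : Digraph n) (B : Subset n) → Decidable (Forces H B)
forces? H B v w = (hasLoop? H ⊎-dec v ∈? B) ×-dec (⁅ w ⁆ ≟ˢ (N⁺ H v ─ B))

B^ : ℕ → Digraph n → Subset n → Subset n
B^ zero    H S = S
B^ (suc i) H S = B ∪ tabulate λ w → does (any? λ v → forces? H B v w)
  where B = B^ i H S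

ZFS : Digraph n → Subset n → Set
ZFS H S = ∃[ t ] B^ t H S ≡ ⊤

FZFS : Digraph n → Subset n → Set
FZFS H S = ¬ ZFS H S

-- Z and F are given by their graphs: "Z H is k" and "F H is k".
-- No k satisfies the latter when H has no failed zero forcing set.
Z_is_ : Digraph n → ℕ → Set
Z H is k = (∃[ S ] (ZFS H S × ∣ S ∣ ≡ k)) × (∀ S → ZFS H S → k ≤ ∣ S ∣)

F_is_ : Digraph n → ℕ → Set
F H is k = (∃[ S ] (FZFS H S × ∣ S ∣ ≡ k)) × (∀ S → FZFS H S → ∣ S ∣ ≤ k)

{-# OPTIONS --safe #-}
module Submission where

-- In both rules the closure of S is the smallest superset of S admitting no
-- further force, so the largest failed sets are the largest proper "stuck"
-- sets.  The in-neighbours of an arc a in L(D) are the arcs whose head is the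
-- tail of a, and they all have the same out-neighbours.  Hence an arc out of a
-- source can never be forced, two arcs with a common tail block each other,
-- and without sources a stuck proper set always misses two arcs.  If there is
-- neither a source nor a pair of arcs with a common tail, every vertex has
-- in-degree and out-degree 1, so D is a permutation, and weak connectedness
-- makes it a single cycle, around which one arc forces all the others.

open import Data.Bool using (true; false)
open import Data.Fin using (Fin; toℕ; fromℕ; fromℕ<; inject₁; punchIn) renaming (zero to fzero; suc to fsuc)
open import Data.Fin.Permutation using (permutation; _⟨$⟩ʳ_; _⟨$⟩ˡ_; inverseʳ)
open import Data.Fin.Properties
  using (any?; pigeonhole; injective⇒≤; fromℕ<-injective; toℕ-fromℕ<; toℕ<n; toℕ-injective;
         toℕ-fromℕ; toℕ-inject₁; punchInᵢ≢i; ¬∀⟶∃¬)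
  renaming (_≟_ to _≟ᶠ_)
open import Data.Fin.Subset
  using (Subset; ⊤; ⊥; ⁅_⁆; _∈_; _∉_; _⊆_; _⊂_; _∪_; _─_; _-_; ∣_∣; Empty)
open import Data.Fin.Subset.Properties
open import Data.List using (List; lookup)
open import Data.List.Membership.Propositional.Properties using (∈-lookup)
open import Data.List.Relation.Unary.Any using (index)
open import Data.List.Relation.Unary.Any.Properties using (lookup-index)
open import Data.List.Relation.Unary.All as All using ()
open import Data.List.Relation.Unary.AllPairs using (_∷_)
open import Data.List.Relation.Unary.Unique.Propositional using (Unique)
open import Data.Nat using (ℕ; zero; suc; _+_; _*_; _≤_; _<_; _≥_; _>_; z≤n; s≤s; NonZero; _%_; _/_)
open import Data.Nat.DivMod using (m%n<n; m≡m%n+[m/n]*n)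
open import Data.Nat.GeneralisedArithmetic using (fold; fold-+)
open import Data.Nat.Properties hiding (_≟_)
open import Data.Product using (_×_; _,_; proj₁; proj₂; ∃-syntax)
open import Data.Sum using (_⊎_; inj₁; inj₂; [_,_]′)
open import Data.Vec using (tabulate; _∷_; here; there)
open import Data.Vec.Properties using (lookup∘tabulate; []=⇒lookup; lookup⇒[]=)
open import Function using (_∘_; case_of_; Equivalence; mk⇔)
open import Function.Definitions using (Injective)
open import Level using (0ℓ)
open import Relation.Binary using (tri<; tri≈; tri>)
open import Relation.Binary.Construct.Closure.Equivalence using () renaming (fold to EqClosure-fold)
open import Relation.Binary.Construct.Closure.ReflexiveTransitive using (ε; _◅_)
open import Relation.Binary.Construct.Closure.Symmetric using (fwd; bwd)
open import Relation.Binary.PropositionalEquality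
open import Relation.Nullary using (yes; no; does; ¬_; ¬?; contradiction; _×-dec_)
open import Relation.Nullary.Decidable using (dec-true; decidable-stable)
open import Relation.Unary using (Pred; Decidable)
open import Defs

private
  variable
    n : ℕ

-- Subsets of a finite set: membership, complements and sizes.

∈-tabulate⁺ : {P : Pred (Fin n) 0ℓ} (P? : Decidable P) → ∀ {x} → P x → x ∈ tabulate (does ∘ P?)
∈-tabulate⁺ P? {x} px =
  lookup⇒[]= x _ (trans (lookup∘tabulate (does ∘ P?) x) (dec-true (P? x) px))

∈-tabulate⁻ : {P : Pred (Fin n) 0ℓ} (P? : Decidable P) → ∀ {x} → x ∈ tabulate (does ∘ P?) → P x
∈-tabulate⁻ P? {x} x∈ with P? x | trans (sym (lookup∘tabulate (does ∘ P?) x)) ([]=⇒lookup x∈)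
... | yes px | _ = px

x∈p─q⇒x∉q : ∀ (p q : Subset n) {x} → x ∈ p ─ q → x ∉ q
x∈p─q⇒x∉q (_ ∷ p) (true  ∷ q) (there x∈) (there x∈q) = x∈p─q⇒x∉q p q x∈ x∈q
x∈p─q⇒x∉q (_ ∷ p) (false ∷ q) (there x∈) (there x∈q) = x∈p─q⇒x∉q p q x∈ x∈q

x∉p-y⇒x≡y : ∀ {p : Subset n} {x y} → x ∈ p → x ∉ p - y → x ≡ y
x∉p-y⇒x≡y {x = x} {y} x∈p x∉ = decidable-stable (x ≟ᶠ y) (x∉ ∘ x∈p∧x≢y⇒x∈p-y x∈p)

x∉p-x : ∀ (p : Subset n) {x} → x ∉ p - x
x∉p-x p {x} x∈ = x∈p─q⇒x∉q p ⁅ x ⁆ x∈ (x∈⁅x⁆ x)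

x∈p⇒1+∣p-x∣≡∣p∣ : ∀ {p : Subset n} {x} → x ∈ p → suc ∣ p - x ∣ ≡ ∣ p ∣
x∈p⇒1+∣p-x∣≡∣p∣ {p = true ∷ p} here = cong (suc ∘ ∣_∣) (p─⊥≡p p)
x∈p⇒1+∣p-x∣≡∣p∣ {p = true ∷ p} (there x∈p) = cong suc (x∈p⇒1+∣p-x∣≡∣p∣ x∈p)
x∈p⇒1+∣p-x∣≡∣p∣ {p = false ∷ p} (there x∈p) = x∈p⇒1+∣p-x∣≡∣p∣ x∈p

1+∣⊤-x∣≡n : ∀ (x : Fin n) → suc ∣ ⊤ - x ∣ ≡ n
1+∣⊤-x∣≡n {n} x = trans (x∈p⇒1+∣p-x∣≡∣p∣ {p = ⊤} {x} ∈⊤) (∣⊤∣≡n n)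

x≢y⇒2+∣⊤-x-y∣≡n : ∀ {x y : Fin n} → x ≢ y → suc (suc ∣ ⊤ - x - y ∣) ≡ n
x≢y⇒2+∣⊤-x-y∣≡n {x = x} {y} x≢y =
  trans (cong suc (x∈p⇒1+∣p-x∣≡∣p∣ {p = ⊤ - x} (x∈p∧x≢y⇒x∈p-y ∈⊤ (x≢y ∘ sym)))) (1+∣⊤-x∣≡n x)

x∉p⇒p⊂p∪⁅x⁆ : ∀ {p : Subset n} {x} → x ∉ p → p ⊂ p ∪ ⁅ x ⁆
x∉p⇒p⊂p∪⁅x⁆ {p = p} {x} x∉p = p⊆p∪q ⁅ x ⁆ , x , q⊆p∪q p _ (x∈⁅x⁆ x) , x∉p

x∉p⇒∣p∣<n : ∀ {p : Subset n} {x} → x ∉ p → ∣ p ∣ < n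
x∉p⇒∣p∣<n {n} {p} {x} x∉p = <-≤-trans (p⊂q⇒∣p∣<∣q∣ (x∉p⇒p⊂p∪⁅x⁆ x∉p)) (∣p∣≤n (p ∪ ⁅ x ⁆))

x≢y∉p⇒1+∣p∣<n : ∀ {p : Subset n} {x y} → x ≢ y → x ∉ p → y ∉ p → suc ∣ p ∣ < n
x≢y∉p⇒1+∣p∣<n {p = p} {x} {y} x≢y x∉p y∉p = ≤-<-trans (p⊂q⇒∣p∣<∣q∣ (x∉p⇒p⊂p∪⁅x⁆ x∉p))
  (x∉p⇒∣p∣<n ([ y∉p , x≢y ∘ sym ∘ x∈⁅y⁆⇒x≡y x ]′ ∘ x∈p∪q⁻ p ⁅ x ⁆))

≢⊤⇒∃∉ : ∀ {p : Subset n} → p ≢ ⊤ → ∃[ x ] x ∉ p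
≢⊤⇒∃∉ {n} {p} p≢⊤ = ¬∀⟶∃¬ n (_∈ p) (_∈? p) λ all∈ → p≢⊤ (⊆-antisym ⊆⊤ λ {x} _ → all∈ x)

n≥2⇒∃≢ : n ≥ 2 → ∀ (v : Fin n) → ∃[ w ] v ≢ w
n≥2⇒∃≢ {suc zero} (s≤s ()) _
n≥2⇒∃≢ {suc (suc _)} _ v = punchIn v fzero , punchInᵢ≢i v fzero ∘ sym

-- Forces, stuck sets and failed sets in an arbitrary digraph.

module _ (H : Digraph n) where

  -- This lemma and the next three trade the subset equation inside `Forces` for statements about
  -- single arcs; later arguments use only these.
  forces⇒arc : ∀ {B v w} → Forces H B v w → Arc H v w
  forces⇒arc {B} {v} {w} (_ , eq) =
    ∈-tabulate⁻ (arc? H v) (p─q⊆p (N⁺ H v) B (subst (w ∈_) eq (x∈⁅x⁆ w)))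

  forces⇒∉ : ∀ {B v w} → Forces H B v w → w ∉ B
  forces⇒∉ {B} {v} {w} (_ , eq) = x∈p─q⇒x∉q (N⁺ H v) B (subst (w ∈_) eq (x∈⁅x⁆ w))

  forces⇒unique : ∀ {B v w x} → Forces H B v w → Arc H v x → x ∉ B → x ≡ w
  forces⇒unique {B} {v} {w} {x} (_ , eq) vx x∉B = x∈⁅y⁆⇒x≡y w
    (subst (x ∈_) (sym eq) (x∈p∧x∉q⇒x∈p─q (∈-tabulate⁺ (arc? H v) vx) x∉B))

  forces⁺ : ∀ {B v w} → HasLoop H ⊎ v ∈ B → Arc H v w → w ∉ B →
            (∀ {x} → Arc H v x → x ∉ B → x ≡ w) → Forces H B v w
  forces⁺ {B} {v} {w} active vw w∉B uniq = active , ⊆-antisym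
    (λ x∈ → subst (_∈ _) (sym (x∈⁅y⁆⇒x≡y w x∈)) (x∈p∧x∉q⇒x∈p─q (∈-tabulate⁺ (arc? H v) vw) w∉B))
    (λ x∈ → subst (_∈ ⁅ w ⁆)
              (sym (uniq (∈-tabulate⁻ (arc? H v) (p─q⊆p (N⁺ H v) B x∈)) (x∈p─q⇒x∉q (N⁺ H v) B x∈)))
              (x∈⁅x⁆ w))

  Stuck : Subset n → Set
  Stuck B = ∀ v w → ¬ Forces H B v w

  B^-⊆ : ∀ S t → S ⊆ B^ t H S
  B^-⊆ S zero    = ⊆-refl
  B^-⊆ S (suc t) = ⊆-trans (B^-⊆ S t) (p⊆p∪q _)

  stuck⇒B^⊆ : ∀ {S} → Stuck S → ∀ t → B^ t H S ⊆ S
  stuck⇒B^⊆ stuck zero x∈ = x∈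
  stuck⇒B^⊆ {S} stuck (suc t) {x} x∈ with x∈p∪q⁻ (B^ t H S) _ x∈
  ... | inj₁ x∈B = stuck⇒B^⊆ stuck t x∈B
  ... | inj₂ x∈new with ∈-tabulate⁻ (λ w → any? λ v → forces? H (B^ t H S) v w) x∈new
  -- By induction `B^ t H S` equals `S`, so a force at stage `t` is already a force from `S`.
  ...   | v , vx = contradiction
            (subst (λ B → Forces H B v x) (⊆-antisym (stuck⇒B^⊆ stuck t) (B^-⊆ S t)) vx)
            (stuck v x)

  stuck⇒FZFS : ∀ {S x} → Stuck S → x ∉ S → FZFS H S
  stuck⇒FZFS {x = x} stuck x∉S (t , eq) = x∉S (stuck⇒B^⊆ stuck t (subst (x ∈_) (sym eq) ∈⊤))

  forces⇒B^-⊂ : ∀ S t {v w} → Forces H (B^ t H S) v w → B^ t H S ⊂ B^ (suc t) H S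
  forces⇒B^-⊂ S t {v} {w} vw = p⊆p∪q _ , w ,
    q⊆p∪q (B^ t H S) _ (∈-tabulate⁺ (λ w → any? λ v → forces? H (B^ t H S) v w) (v , vw)) ,
    forces⇒∉ vw

  -- Every stage with a force strictly enlarges the set, which can happen at most `n` times.
  B^-stabilises : ∀ S → ∃[ t ] Stuck (B^ t H S)
  B^-stabilises S = go n 0 (m≤m+n n _)
    where
    -- The invariant says that `fuel` covers all vertices still missing. At fuel 0 the set has size
    -- `n`, yet a forced vertex would lie outside it.
    go : ∀ fuel t → n ≤ fuel + ∣ B^ t H S ∣ → ∃[ t ] Stuck (B^ t H S)
    go fuel t bound with any? (λ v → any? (λ w → forces? H (B^ t H S) v w))
    ... | no  ¬vw = t , λ v w vw → ¬vw (v , w , vw)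
    go zero t bound | yes (v , w , vw) =
      contradiction (x∉p⇒∣p∣<n (forces⇒∉ vw)) (≤⇒≯ bound)
    go (suc fuel) t bound | yes (v , w , vw) = go fuel (suc t) (≤-trans
      (subst (n ≤_) (sym (+-suc fuel _)) bound)
      (+-monoʳ-≤ fuel (p⊂q⇒∣p∣<∣q∣ (forces⇒B^-⊂ S t vw))))

  -- Upper bounds on failed sets come from here: `S` misses every vertex that `T` misses, so it
  -- suffices to study proper stuck sets.
  FZFS⇒stuck : ∀ {S} → FZFS H S → ∃[ T ] (S ⊆ T × Stuck T × (∃[ x ] x ∉ T))
  FZFS⇒stuck {S} failed with B^-stabilises S
  ... | t , stuck = B^ t H S , B^-⊆ S t , stuck , ≢⊤⇒∃∉ (failed ∘ (t ,_))

-- Periods of iterated maps; `fold x s k` is the k-th iterate of `s` at `x`.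

fold-injective : ∀ {A : Set} {s : A → A} → Injective _≡_ _≡_ s →
                 ∀ k {x y} → fold x s k ≡ fold y s k → x ≡ y
fold-injective s-inj zero    eq = eq
fold-injective s-inj (suc k) eq = fold-injective s-inj k (s-inj eq)

module _ {A : Set} (s : A → A) {x : A} where

  fold-*-period : ∀ {d} → fold x s d ≡ x → ∀ q → fold x s (q * d) ≡ x
  fold-*-period per zero = refl
  fold-*-period {d} per (suc q) =
    trans (fold-+ x s d) (trans (cong (λ y → fold y s d) (fold-*-period per q)) per)

  fold-%-period : ∀ d .{{_ : NonZero d}} → fold x s d ≡ x → ∀ k → fold x s (k % d) ≡ fold x s k
  fold-%-period d per k = sym (begin
    fold x s k                                ≡⟨ cong (fold x s) (m≡m%n+[m/n]*n k d) ⟩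
    fold x s (k % d + k / d * d)              ≡⟨ fold-+ x s (k % d) ⟩
    fold (fold x s (k / d * d)) s (k % d)     ≡⟨ cong (λ y → fold y s (k % d)) (fold-*-period per (k / d)) ⟩
    fold x s (k % d)                          ∎)
    where open ≡-Reasoning

-- Cancelling the `i` common applications of `s` leaves the period `j - i`, written `suc r` to keep
-- it positive.
fold-collision : ∀ {A : Set} {s : A → A} → Injective _≡_ _≡_ s → ∀ {x i j} → i < j →
                 fold x s i ≡ fold x s j → ∃[ r ] (suc r ≤ j × fold x s (suc r) ≡ x)
fold-collision {s = s} s-inj {x} {i} {j} i<j eq with m≤n⇒∃[o]m+o≡n i<j
... | r , refl = r , s≤s (m≤n+m r i) , sym (fold-injective s-inj i
  (trans eq (trans (cong (fold x s) (sym (+-suc i r))) (fold-+ x s i))))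

injective⇒periodic : ∀ {s : Fin n → Fin n} → Injective _≡_ _≡_ s →
                     ∀ x → ∃[ r ] (suc r ≤ n × fold x s (suc r) ≡ x)
-- The iterates with exponents 0 to `n` are `n + 1` points among `n`, so two of them coincide.
injective⇒periodic {n} {s} s-inj x with pigeonhole (n<1+n n) (fold x s ∘ toℕ)
... | i , j , i<j , eq with fold-collision s-inj i<j eq
...   | r , r<j , per = r , ≤-trans r<j (≤-pred (toℕ<n j)) , per

-- Only forward iterates are allowed; an injective `s` with this property is a permutation
-- consisting of a single cycle.
Transitive : (Fin n → Fin n) → Set
Transitive s = ∀ x y → ∃[ k ] fold x s k ≡ y

module _ {s : Fin n → Fin n} (s-trans : Transitive s) where

  -- Reduced modulo the period, the times at which the points are reached stay distinct, which
  -- embeds `Fin n` into `Fin (suc r)`.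
  transitive⇒period≥n : ∀ {x r} → fold x s (suc r) ≡ x → n ≤ suc r
  transitive⇒period≥n {x} {r} per = injective⇒≤ {f = time} λ {y} {z} eq → begin
    y                                   ≡⟨ time-correct y ⟨
    fold x s (proj₁ (s-trans x y) % suc r) ≡⟨ cong (fold x s) (fromℕ<-injective _ _ _ _ eq) ⟩
    fold x s (proj₁ (s-trans x z) % suc r) ≡⟨ time-correct z ⟩
    z                                   ∎
    where
    open ≡-Reasoning
    time : Fin n → Fin (suc r)
    time y = fromℕ< (m%n<n (proj₁ (s-trans x y)) (suc r))
    time-correct : ∀ y → fold x s (proj₁ (s-trans x y) % suc r) ≡ y
    time-correct y = trans (fold-%-period s (suc r) per (proj₁ (s-trans x y))) (proj₂ (s-trans x y))

  module _ (s-inj : Injective _≡_ _≡_ s) where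

    transitive⇒periodn : ∀ x → fold x s n ≡ x
    transitive⇒periodn x with injective⇒periodic s-inj x
    ... | r , r<n , per = subst (λ d → fold x s d ≡ x) (≤-antisym r<n (transitive⇒period≥n per)) per

    fold-injective-<n : ∀ {x i j} → i < n → j < n → fold x s i ≡ fold x s j → i ≡ j
    fold-injective-<n {x} {i} {j} i<n j<n eq with <-cmp i j
    ... | tri≈ _ i≡j _ = i≡j
    ... | tri< i<j _ _ with fold-collision s-inj i<j eq
    ...   | r , r<j , per = contradiction (transitive⇒period≥n per) (<⇒≱ (≤-<-trans r<j j<n))
    fold-injective-<n {x} {i} {j} i<n j<n eq | tri> _ _ j<i with fold-collision s-inj j<i (sym eq)
    ...   | r , r<i , per = contradiction (transitive⇒period≥n per) (<⇒≱ (≤-<-trans r<i i<n))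

-- Directed cycles and their successor relation.

transitive⇒cycle : ∀ (D : Digraph n) {s : Fin n → Fin n} → Transitive s → Injective _≡_ _≡_ s →
                   (∀ u → Arc D u (s u)) → (∀ {u v} → Arc D u v → s u ≡ v) →
                   Fin n → IsDirectedCycle D
transitive⇒cycle {n@(suc _)} D {s} s-trans s-inj arc-s s-unique x =
  permutation at time at-time time-at , λ i j → mk⇔ (to i j ∘ s-unique) (from i j)
  where
  -- Label `i` goes to the vertex reached from `x` in `i` steps; `time` inverts this by reducing an
  -- arrival time modulo `n`.
  at : Fin n → Fin n
  at i = fold x s (toℕ i)
  time : Fin n → Fin n
  time y = fromℕ< (m%n<n (proj₁ (s-trans x y)) n)
  at-time : ∀ y → at (time y) ≡ y
  at-time y = trans (cong (fold x s) (toℕ-fromℕ< (m%n<n (proj₁ (s-trans x y)) n)))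
    (trans (fold-%-period s n (transitive⇒periodn s-trans s-inj x) (proj₁ (s-trans x y))) (proj₂ (s-trans x y)))
  time-at : ∀ i → time (at i) ≡ i
  time-at i = toℕ-injective (fold-injective-<n s-trans s-inj {x} (toℕ<n _) (toℕ<n i) (at-time (at i)))
  to : ∀ i j → s (at i) ≡ at j → CyclicSucc i j
  to i j eq with m≤n⇒m<n∨m≡n (toℕ<n i)
  ... | inj₁ 1+i<n = inj₁ (fold-injective-<n s-trans s-inj {x} 1+i<n (toℕ<n j) eq)
  -- From the last label, one more step completes the period `n` and returns to `x`, which has label
  -- 0.
  ... | inj₂ 1+i≡n = inj₂ (1+i≡n , sym (fold-injective-<n s-trans s-inj {x} (s≤s z≤n) (toℕ<n j)
    (trans (sym (transitive⇒periodn s-trans s-inj x)) (trans (cong (fold x s) (sym 1+i≡n)) eq))))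
  from : ∀ i j → CyclicSucc i j → Arc D (at i) (at j)
  from i j (inj₁ eq) = subst (Arc D (at i) ∘ fold x s) eq (arc-s (at i))
  from i j (inj₂ (1+i≡n , j≡0)) = subst (Arc D (at i))
    (trans (cong (fold x s) 1+i≡n)
      (trans (transitive⇒periodn s-trans s-inj x) (cong (fold x s) (sym j≡0))))
    (arc-s (at i))

-- Reachability by iterates of `s` contains all arcs and, as `s` is injective on a finite set, is an
-- equivalence relation; hence it contains the equivalence closure of the arcs.
connected⇒transitive : ∀ (D : Digraph n) {s : Fin n → Fin n} → WeaklyConnected D →
                       Injective _≡_ _≡_ s → (∀ {u v} → Arc D u v → s u ≡ v) → Transitive s
connected⇒transitive {n} D {s} conn s-inj s-unique u v =
  EqClosure-fold (record { refl = 0 , refl ; sym = flip ; trans = compose }) (λ uv → 1 , s-unique uv) (conn u v)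
  where
  compose : ∀ {x y z} → ∃[ k ] fold x s k ≡ y → ∃[ k ] fold y s k ≡ z → ∃[ k ] fold x s k ≡ z
  compose {x} (k , refl) (l , refl) = l + k , fold-+ x s l
  flip : ∀ {x y} → ∃[ k ] fold x s k ≡ y → ∃[ k ] fold y s k ≡ x
  flip {x} (k , refl) with injective⇒periodic s-inj x
  -- To undo `k` steps, go `k * r` further: the total `k * suc r` is a multiple of the period of
  -- `x`.
  ... | r , _ , per = k * r , (begin
    fold (fold x s k) s (k * r) ≡⟨ fold-+ x s (k * r) ⟨
    fold x s (k * r + k)        ≡⟨ cong (fold x s) (trans (+-comm (k * r) k) (sym (*-suc k r))) ⟩
    fold x s (k * suc r)        ≡⟨ fold-*-period s per k ⟩
    x                           ∎)
    where open ≡-Reasoning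

cyclicSucc-functional : ∀ {i j k : Fin n} → CyclicSucc i j → CyclicSucc i k → j ≡ k
cyclicSucc-functional (inj₁ p) (inj₁ q) = toℕ-injective (trans (sym p) q)
cyclicSucc-functional {j = j} (inj₁ p) (inj₂ (q , _)) = contradiction (trans (sym p) q) (<⇒≢ (toℕ<n j))
cyclicSucc-functional {k = k} (inj₂ (p , _)) (inj₁ q) = contradiction (trans (sym q) p) (<⇒≢ (toℕ<n k))
cyclicSucc-functional (inj₂ (_ , p)) (inj₂ (_ , q)) = toℕ-injective (trans p (sym q))

cyclicPred : ∀ (j : Fin n) → ∃[ i ] CyclicSucc i j
cyclicPred {suc n} fzero    = fromℕ n , inj₂ (cong suc (toℕ-fromℕ n) , refl)
cyclicPred {suc n} (fsuc j) = inject₁ j , inj₁ (cong suc (toℕ-inject₁ j))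

-- Arcs of `D` and stuck sets of its line digraph.

unique⇒lookup-injective : ∀ {A : Set} {xs : List A} → Unique xs → Injective _≡_ _≡_ (lookup xs)
unique⇒lookup-injective (_  ∷ _)  {fzero}  {fzero}  _  = refl
unique⇒lookup-injective (x≢ ∷ _)  {fzero}  {fsuc j} eq = contradiction eq (All.lookup x≢ (∈-lookup j))
unique⇒lookup-injective (x≢ ∷ _)  {fsuc i} {fzero}  eq = contradiction (sym eq) (All.lookup x≢ (∈-lookup i))
unique⇒lookup-injective (_  ∷ xs) {fsuc i} {fsuc j} eq = cong fsuc (unique⇒lookup-injective xs eq)

module _ (D : Digraph n) where

  cycle⇒¬source : IsDirectedCycle D → ¬ HasSource D
  cycle⇒¬source (π , arcs⇔) (v , noIn) with cyclicPred (π ⟨$⟩ˡ v)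
  ... | i , succ = noIn (π ⟨$⟩ʳ i , ∈-tabulate⁺ (λ u → arc? D u v)
    (subst (Arc D _) (inverseʳ π) (Equivalence.from (arcs⇔ _ _) succ)))

  cycle⇒out-unique : IsDirectedCycle D → ∀ {u v w} → Arc D u v → Arc D u w → v ≡ w
  cycle⇒out-unique (π , arcs⇔) {u} {v} {w} uv uw = begin
    v                     ≡⟨ inverseʳ π ⟨
    π ⟨$⟩ʳ (π ⟨$⟩ˡ v)     ≡⟨ cong (π ⟨$⟩ʳ_) (cyclicSucc-functional (pull uv) (pull uw)) ⟩
    π ⟨$⟩ʳ (π ⟨$⟩ˡ w)     ≡⟨ inverseʳ π ⟩
    w                     ∎
    where
    open ≡-Reasoning
    pull : ∀ {x y} → Arc D x y → CyclicSucc (π ⟨$⟩ˡ x) (π ⟨$⟩ˡ y)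
    pull xy = Equivalence.to (arcs⇔ _ _) (subst₂ (Arc D) (sym (inverseʳ π)) (sym (inverseʳ π)) xy)

  arc-at : ∀ a → Arc D (tail D a) (head D a)
  arc-at a = Equivalence.to (∈-arcs D _ _) (∈-lookup {xs = arcs D} a)

  arc-index : ∀ {u v} → Arc D u v → ∃[ a ] (tail D a ≡ u × head D a ≡ v)
  arc-index {u} {v} uv = index uv∈ , cong proj₁ (sym eq) , cong proj₂ (sym eq)
    where
    uv∈ = Equivalence.from (∈-arcs D u v) uv
    eq = lookup-index uv∈

  arc-ext : ∀ {a b} → tail D a ≡ tail D b → head D a ≡ head D b → a ≡ b
  arc-ext t h = unique⇒lookup-injective (arcs-unique D) (cong₂ _,_ t h)

  ¬source⇒in-arc : ¬ HasSource D → ∀ v → ∃[ a ] head D a ≡ v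
  ¬source⇒in-arc ¬source v with nonempty? (N⁻ D v)
  ... | no  empty    = contradiction (v , empty) ¬source
  ... | yes (u , u∈) with arc-index (∈-tabulate⁻ (λ u → arc? D u v) u∈)
  ...   | a , _ , h = a , h

  -- Only `a` is missing, so only `a` could be forced, and the forcing arc would have to end at a
  -- source.
  source⇒stuck : ∀ {a} → Empty (N⁻ D (tail D a)) → Stuck (L D) (⊤ - a)
  source⇒stuck {a} noIn b c bc with x∉p-y⇒x≡y ∈⊤ (forces⇒∉ (L D) bc)
  ... | refl = noIn (tail D b , ∈-tabulate⁺ (λ u → arc? D u (tail D a))
    (subst (Arc D (tail D b)) (forces⇒arc (L D) bc) (arc-at b)))

  -- An undirected path from `v` to another vertex has a first step, and at a source this step must
  -- follow an arc forwards.
  source⇒out-arc : WeaklyConnected D → ∀ {v w} → v ≢ w → Empty (N⁻ D v) → ∃[ a ] tail D a ≡ v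
  source⇒out-arc conn {v} {w} v≢w noIn with conn v w
  ... | ε          = contradiction refl v≢w
  ... | fwd vu ◅ _ = let a , t , _ = arc-index vu in a , t
  ... | bwd uv ◅ _ = contradiction (_ , ∈-tabulate⁺ (λ u → arc? D u v) uv) noIn

  -- An arc `c` forcing one of the two missing arcs has both as out-neighbours, since they share a
  -- tail; uniqueness of the missing out-neighbour then gives `a ≡ b`.
  branch⇒stuck : ∀ {a b} → a ≢ b → tail D a ≡ tail D b → Stuck (L D) (⊤ - a - b)
  branch⇒stuck {a} {b} a≢b t c d cd = a≢b (trans
      (forces⇒unique (L D) cd (ca d∈) (x∉p-x ⊤ ∘ p─q⊆p (⊤ - a) ⁅ b ⁆))
      (sym (forces⇒unique (L D) cd (trans (ca d∈) t) (x∉p-x (⊤ - a)))))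
    where
    d∈ : d ≡ a ⊎ d ≡ b
    d∈ with d ≟ᶠ a
    ... | yes d≡a = inj₁ d≡a
    ... | no  d≢a = inj₂ (x∉p-y⇒x≡y (x∈p∧x≢y⇒x∈p-y ∈⊤ d≢a) (forces⇒∉ (L D) cd))
    ca : d ≡ a ⊎ d ≡ b → head D c ≡ tail D a
    ca (inj₁ refl) = forces⇒arc (L D) cd
    ca (inj₂ refl) = trans (forces⇒arc (L D) cd) (sym t)

  -- An arc b into the tail of a would force a if a were the only arc missing
  -- from T; when b is itself missing, b = a is a loop and may force from outside.
  ¬source⇒stuck-misses-two : ¬ HasSource D → ∀ {T a} → Stuck (L D) T → a ∉ T → ∃[ b ] (a ≢ b × b ∉ T)
  ¬source⇒stuck-misses-two ¬source {T} {a} stuck a∉T with any? (λ b → ¬? (a ≟ᶠ b) ×-dec ¬? (b ∈? T))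
  ... | yes found = found
  ... | no  ¬other with ¬source⇒in-arc ¬source (tail D a)
  ...   | b , h = contradiction (forces⁺ (L D) active h a∉T (λ _ → only)) (stuck b a)
    where
    only : ∀ {x} → x ∉ T → x ≡ a
    only {x} x∉T = sym (decidable-stable (a ≟ᶠ x) λ a≢x → ¬other (x , a≢x , x∉T))
    active : HasLoop (L D) ⊎ b ∈ T
    active with b ∈? T
    ... | yes b∈T = inj₂ b∈T
    ... | no  b∉T = inj₁ (b , trans h (cong (tail D) (sym (only b∉T))))

  -- Choosing an in-arc at each vertex gives a predecessor map `p`. It is injective because
  -- out-degrees are at most 1, hence a permutation of the finite vertex set, and its inverse
  -- supplies an out-arc everywhere.
  unbranched⇒succ : ¬ HasSource D → Injective _≡_ _≡_ (tail D) →
    ∃[ s ] (Injective _≡_ _≡_ s × (∀ u → Arc D u (s u)) × (∀ {u v} → Arc D u v → s u ≡ v))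
  unbranched⇒succ ¬source tail-inj = s , s-inj , arc-s , out-unique (arc-s _)
    where
    out-unique : ∀ {u v w} → Arc D u v → Arc D u w → v ≡ w
    out-unique uv uw with arc-index uv | arc-index uw
    ... | a , refl , refl | b , t , refl = cong (head D) (tail-inj (sym t))
    in-arc : Fin n → Fin (∣A∣ D)
    in-arc v = proj₁ (¬source⇒in-arc ¬source v)
    p : Fin n → Fin n
    p = tail D ∘ in-arc
    arc-p : ∀ v → Arc D (p v) v
    arc-p v = subst (Arc D (p v)) (proj₂ (¬source⇒in-arc ¬source v)) (arc-at (in-arc v))
    p-inj : Injective _≡_ _≡_ p
    p-inj {v} {w} eq = out-unique (arc-p v) (subst (λ u → Arc D u w) (sym eq) (arc-p w))
    -- p has finite order, so its inverse is one of its powers at each point.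
    s : Fin n → Fin n
    s x = fold x p (proj₁ (injective⇒periodic p-inj x))
    p∘s : ∀ x → p (s x) ≡ x
    p∘s x = proj₂ (proj₂ (injective⇒periodic p-inj x))
    s-inj : Injective _≡_ _≡_ s
    s-inj {x} {y} eq = trans (sym (p∘s x)) (trans (cong p eq) (p∘s y))
    arc-s : ∀ u → Arc D u (s u)
    arc-s u = subst (λ w → Arc D w (s u)) (p∘s u) (arc-p (s u))

  -- Membership in `T` spreads along the orbit of the tail of `a`: each arc has just one
  -- out-neighbour in `L D`, so an arc of `T` would force its successor if that were missing.
  transitive⇒stuck-full : ∀ {s} → Transitive s → (∀ u → Arc D u (s u)) → (∀ {u v} → Arc D u v → s u ≡ v) →
    Injective _≡_ _≡_ (tail D) → ∀ {T a} → Stuck (L D) T → a ∈ T → ∀ c → c ∈ T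
  transitive⇒stuck-full {s} s-trans arc-s s-unique tail-inj {T} {a} stuck a∈T c =
    let k , eq = s-trans (tail D a) (tail D c) in go k c (sym eq)
    where
    go : ∀ k c → tail D c ≡ fold (tail D a) s k → c ∈ T
    go zero    c t = subst (_∈ T) (sym (tail-inj t)) a∈T
    go (suc k) c t with arc-index (arc-s (fold (tail D a) s k))
    ... | b , tb , hb = decidable-stable (c ∈? T) λ c∉T → stuck b c
      (forces⁺ (L D) (inj₂ (go k b tb)) bc c∉T (λ bx _ → tail-inj (trans (sym bx) bc)))
      where
      bc : head D b ≡ tail D c
      bc = trans hb (sym t)

  -- Without loops the empty set has no vertex that may force. A loop in `L D` would give a fixed
  -- point of `s`, that is, an orbit of size 1 filling at least two vertices.
  transitive⇒⊥-stuck : n ≥ 2 → ∀ {s} → Transitive s → (∀ {u v} → Arc D u v → s u ≡ v) → Stuck (L D) ⊥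
  transitive⇒⊥-stuck n≥2 s-trans s-unique v w (inj₂ v∈⊥ , _) = ∉⊥ v∈⊥
  transitive⇒⊥-stuck n≥2 s-trans s-unique v w (inj₁ (a , loop) , _) = <⇒≱ n≥2
    (transitive⇒period≥n s-trans {r = 0} (trans (s-unique (arc-at a)) loop))

  -- The value of `F (L D)` in each case.

  source⇒F : ∀ {a} → Empty (N⁻ D (tail D a)) → F (L D) is ∣ ⊤ - a ∣
  source⇒F {a} noIn =
    (⊤ - a , stuck⇒FZFS (L D) (source⇒stuck noIn) (x∉p-x ⊤) , refl) ,
    λ S failed → let T , S⊆T , _ , _ , x∉T = FZFS⇒stuck (L D) failed in
      ≤-pred (subst (∣ S ∣ <_) (sym (1+∣⊤-x∣≡n a)) (x∉p⇒∣p∣<n (x∉T ∘ S⊆T)))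

  branch⇒F : ¬ HasSource D → ∀ {a b} → a ≢ b → tail D a ≡ tail D b → F (L D) is ∣ ⊤ - a - b ∣
  branch⇒F ¬source {a} {b} a≢b t =
    (⊤ - a - b , stuck⇒FZFS (L D) (branch⇒stuck a≢b t) (x∉p-x (⊤ - a)) , refl) ,
    λ S failed →
      let T , S⊆T , stuck , x , x∉T = FZFS⇒stuck (L D) failed
          y , x≢y , y∉T = ¬source⇒stuck-misses-two ¬source stuck x∉T
      in ≤-pred (≤-pred (subst (suc ∣ S ∣ <_) (sym (x≢y⇒2+∣⊤-x-y∣≡n a≢b))
                                (x≢y∉p⇒1+∣p∣<n x≢y (x∉T ∘ S⊆T) (y∉T ∘ S⊆T))))

  permutation⇒F : n ≥ 2 → ∀ {s} → Transitive s → (∀ u → Arc D u (s u)) → (∀ {u v} → Arc D u v → s u ≡ v) →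
                  Injective _≡_ _≡_ (tail D) → F (L D) is 0
  permutation⇒F n≥2 s-trans arc-s s-unique tail-inj =
    (⊥ , stuck⇒FZFS (L D) (transitive⇒⊥-stuck n≥2 s-trans s-unique) (∉⊥ {x = a₀}) , ∣⊥∣≡0 (∣A∣ D)) ,
    λ S failed →
      let T , S⊆T , stuck , x , x∉T = FZFS⇒stuck (L D) failed
          empty : Empty S
          empty = λ (a , a∈S) →
            x∉T (transitive⇒stuck-full s-trans arc-s s-unique tail-inj stuck (S⊆T a∈S) x)
      in ≤-reflexive (trans (cong ∣_∣ (Empty-unique empty)) (∣⊥∣≡0 (∣A∣ D)))
    where
    -- The empty set is failed only if some arc is missing from it; the arc leaving vertex 0 is one.
    a₀ = proj₁ (arc-index (arc-s (fromℕ< (≤-trans (s≤s z≤n) n≥2))))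

  unbranched⇒F : n ≥ 2 → WeaklyConnected D → ¬ HasSource D → Injective _≡_ _≡_ (tail D) →
                 (F (L D) is 0) × IsDirectedCycle D
  unbranched⇒F n≥2 conn ¬source tail-inj = conclude (unbranched⇒succ ¬source tail-inj)
    where
    conclude : (∃[ s ] (Injective _≡_ _≡_ s × (∀ u → Arc D u (s u)) × (∀ {u v} → Arc D u v → s u ≡ v))) →
               (F (L D) is 0) × IsDirectedCycle D
    conclude (s , s-inj , arc-s , s-unique) =
      permutation⇒F n≥2 s-trans arc-s s-unique tail-inj ,
      transitive⇒cycle D s-trans s-inj arc-s s-unique (fromℕ< (≤-trans (s≤s z≤n) n≥2))
      where
      s-trans : Transitive s
      s-trans = connected⇒transitive D conn s-inj s-unique

theorem4p21 : ∀ (n : ℕ) (D : Digraph n) → n ≥ 2 → WeaklyConnected D →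
    (¬ HasLoop D ⊎ (HasLoop D × (∃[ z ] (Z (L D) is z × z > 0)))) →
    ∃[ f ] ((F (L D) is f) ×
    (IsDirectedCycle D → f ≡ 0) ×
    (HasSource D → f + 1 ≡ ∣A∣ D) ×
    (¬ IsDirectedCycle D → ¬ HasSource D → f + 2 ≡ ∣A∣ D))
theorem4p21 n D n≥2 conn _ = case any? (λ v → ¬? (nonempty? (N⁻ D v))) of λ where
    (yes (v , noIn)) → sourced noIn (source⇒out-arc D conn (proj₂ (n≥2⇒∃≢ n≥2 v)) noIn)
    (no ¬source)     → sourceless ¬source
  where
  Conclusion : Set
  Conclusion = ∃[ f ] ((F (L D) is f) ×
    (IsDirectedCycle D → f ≡ 0) ×
    (HasSource D → f + 1 ≡ ∣A∣ D) ×
    (¬ IsDirectedCycle D → ¬ HasSource D → f + 2 ≡ ∣A∣ D))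

  sourced : ∀ {v} → Empty (N⁻ D v) → ∃[ a ] tail D a ≡ v → Conclusion
  sourced {v} noIn (a , t) =
    ∣ ⊤ - a ∣ , source⇒F D (subst (Empty ∘ N⁻ D) (sym t) noIn) ,
    (λ cycle → contradiction (v , noIn) (cycle⇒¬source D cycle)) ,
    (λ _ → trans (+-comm ∣ ⊤ - a ∣ 1) (1+∣⊤-x∣≡n a)) ,
    (λ _ ¬source → contradiction (v , noIn) ¬source)

  sourceless : ¬ HasSource D → Conclusion
  sourceless ¬source =
    case any? (λ a → any? (λ b → ¬? (a ≟ᶠ b) ×-dec (tail D a ≟ᶠ tail D b))) of λ where
      (yes (a , b , a≢b , t)) →
        ∣ ⊤ - a - b ∣ , branch⇒F D ¬source a≢b t ,
        -- Out-degrees in a directed cycle are 1, so arcs with a common tail also share their head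
        -- and would coincide.
        (λ cycle → contradiction (arc-ext D t (cycle⇒out-unique D cycle (arc-at D a)
          (subst (λ u → Arc D u (head D b)) (sym t) (arc-at D b)))) a≢b) ,
        (λ source → contradiction source ¬source) ,
        (λ _ _ → trans (+-comm ∣ ⊤ - a - b ∣ 2) (x≢y⇒2+∣⊤-x-y∣≡n a≢b))
      (no ¬branch) →
        -- The absence of branching is exactly injectivity of `tail D`.
        let F≡0 , cycle = unbranched⇒F D n≥2 conn ¬source λ {a} {b} t →
              decidable-stable (a ≟ᶠ b) λ a≢b → ¬branch (a , b , a≢b , t)
        in 0 , F≡0 , (λ _ → refl) ,
           (λ source → contradiction source ¬source) ,
           (λ ¬cycle → contradiction cycle ¬cycle)
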